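{- For any Kripke model $\mathcal{M}$ and any formula $\varphi\in\mathcal{L}$, the model $\mathcal{M}^{\div\varphi}$ obtained by contracting on $\varphi$ is isomorphic to the generalized product update $\mathcal{M}\otimes\mathcal{E}(\div\varphi)$ of $\mathcal{M}$ with the event model $\mathcal{E}(\div\varphi)$ for contraction on $\varphi$.
   Context: Language and models. $At$ is a countable set of atoms, $Ag$ a finite set of agents. The doxastic language $\mathcal{L}$ is given by $\varphi::=\top\mid p\mid\neg\varphi\mid\varphi\wedge\varphi\mid B_a\varphi$ with $p\in At$, $a\in Ag$. A Kripke model is $\mathcal{M}=(W,R,V)$ with $W\neq\emptyset$, $R_a\subseteq W\times W$ arbitrary for each $a\in Ag$, $V:At\to\wp(W)$; $R_a(w)=\{v:(w,v)\in R_a\}$; $\mathcal{M},w\vDash B_a\varphi$ iff $\mathcal{M},v\vDash\varphi$ for all $v\in R_a(w)$; other clauses standard. $\varphi\vDash\psi$ means that every world of every Kripke model satisfying $\varphi$ satisfies $\psi$. An isomorphism of Kripke models is a bijection between their worlds that preserves and reflects each accessibility relation and the valuation of every atom. An empty conjunction is $\top$. Contraction. $\mathcal{M}^{\div\varphi}=(W,R^{\div\varphi},V)$ with $R_a^{\div\varphi}(w)=R_a(w)\cup\{v\in W:\mathcal{M},v\vDash\neg\varphi\}$ if $\mathcal{M},w\vDash B_a\varphi$, and $R_a^{\div\varphi}(w)=R_a(w)$ otherwise. Generalized event models. A generalized event model is $\mathcal{E}=(E,Q,Q^+,pre)$ with $E$ a non-empty finite set of events, $Q_a,Q_a^+\subseteq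 E\times E$ for each $a\in Ag$, and $pre$ a function assigning to each event a formula (here, formulas of $\mathcal{L}$ suffice); $Q_a(e)=\{f:(e,f)\in Q_a\}$, $Q_a^+(e)=\{f:(e,f)\in Q_a^+\}$. The generalized product update is $\mathcal{M}\otimes\mathcal{E}=(W^{\mathcal E},R^{\mathcal E},V^{\mathcal E})$ with $W^{\mathcal E}=\{(w,e)\in W\times E:\mathcal{M},w\vDash pre(e)\}$; for $(w,e),(v,f)\in W^{\mathcal E}$, $(v,f)\in R_a^{\mathcal E}(w,e)$ iff either $f\in Q_a^+(e)$, or $v\in R_a(w)$ and $f\in Q_a(e)$; $V^{\mathcal E}(p)=\{(w,e)\in W^{\mathcal E}:w\in V(p)\}$. Event model for contraction on $\varphi$. $\mathcal{E}(\div\varphi)=(E,Q,Q^+,pre)$ where: (1) $E=\{\varphi\wedge\bigwedge_{a\in A}\neg B_a\varphi\wedge\bigwedge_{a\in Ag\setminus A}B_a\varphi:A\subseteq Ag\}\cup\{\neg\varphi\wedge\bigwedge_{a\in A}\neg B_a\varphi\wedge\bigwedge_{a\in Ag\setminus A}B_a\varphi:A\subseteq Ag\}$; (2) for all $a\in Ag$, $e\in E$: $Q_a(e)=E$, and $Q_a^+(e)=\{f\in E:pre(f)\vDash\neg\varphi\}$ if $pre(e)\vDash B_a\varphi$, and $Q_a^+(e)=\emptyset$ otherwise; (3) $pre(e)=e$ for all $e\in E$. -}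

module Defs where

open import Data.Fin.Base using (Fin)
import Data.Fin.Properties as Fin
open import Data.Fin.Subset using (Subset; inside; outside; ∁) renaming (⊥ to ∅)
open import Data.Fin.Subset.Properties using (_∈?_; anySubset?)
open import Data.Irrelevant using ([_])
open import Data.List.Base using (List; []; _∷_; _++_; map; filter; foldr; allFin)
open import Data.List.Membership.Propositional using (_∈_)
open import Data.List.Membership.Propositional.Properties using (∈-map⁺; ∈-++⁺ˡ; ∈-++⁺ʳ)
open import Data.List.Relation.Unary.Any using (here)
open import Data.List.Relation.Unary.Enumerates.Setoid using (IsEnumeration)
open import Data.Nat.Base using (ℕ; zero; suc)
import Data.Nat.Properties as ℕ
open import Data.Product.Base using (∃; _×_; _,_; proj₁; proj₂)
open import Data.Refinement using (Refinement-syntax; value; _,_)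
open import Data.Sum.Base using (_⊎_; inj₁; inj₂)
open import Data.Unit.Polymorphic.Base using () renaming (⊤ to Unit)
open import Data.Vec.Base using ([]; _∷_)
open import Function.Bundles using (_↣_; _⤖_; _⇔_; module Bijection)
open import Level using (Level; Lift; _⊔_) renaming (suc to lsuc; zero to lzero)
open import Relation.Binary.Core using (Rel)
open import Relation.Binary.Definitions using (DecidableEquality)
open import Relation.Binary.PropositionalEquality using (_≡_; refl; cong; cong₂; setoid)
open import Relation.Nullary.Negation.Core using (¬_)
open import Relation.Nullary.Decidable
  using (Dec; yes; no; map′; recompute; via-injection; _×-dec_; _⊎-dec_)
open import Relation.Unary using (Pred)

-- The language over a countable set At of atoms and the finite set Fin n of
-- agents.  "Countable" means: injects into ℕ (finite sets of atoms included).
module Doxastic (At : Set) (At-countable : At ↣ ℕ) (n : ℕ) where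

  Ag : Set
  Ag = Fin n

  infixr 6 _∧_
  infix  7 ~_

  data Formula : Set where
    ⊤    : Formula
    atom : At → Formula
    ~_   : Formula → Formula
    _∧_  : Formula → Formula → Formula
    B    : Ag → Formula → Formula

  _≟ᶠ_ : DecidableEquality Formula
  ⊤       ≟ᶠ ⊤       = yes refl
  atom p  ≟ᶠ atom q  = map′ (cong atom) (λ { refl → refl }) (via-injection At-countable ℕ._≟_ p q)
  (~ φ)   ≟ᶠ (~ ψ)   = map′ (cong ~_) (λ { refl → refl }) (φ ≟ᶠ ψ)
  (φ ∧ χ) ≟ᶠ (ψ ∧ θ) = map′ (λ (p , q) → cong₂ _∧_ p q) (λ { refl → refl , refl })
                       ((φ ≟ᶠ ψ) ×-dec (χ ≟ᶠ θ))
  B a φ   ≟ᶠ B b ψ   = map′ (λ (p , q) → cong₂ B p q) (λ { refl → refl , refl })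
                       ((a Fin.≟ b) ×-dec (φ ≟ᶠ ψ))
  ⊤       ≟ᶠ atom _  = no λ ()
  ⊤       ≟ᶠ (~ _)   = no λ ()
  ⊤       ≟ᶠ (_ ∧ _) = no λ ()
  ⊤       ≟ᶠ B _ _   = no λ ()
  atom _  ≟ᶠ ⊤       = no λ ()
  atom _  ≟ᶠ (~ _)   = no λ ()
  atom _  ≟ᶠ (_ ∧ _) = no λ ()
  atom _  ≟ᶠ B _ _   = no λ ()
  (~ _)   ≟ᶠ ⊤       = no λ ()
  (~ _)   ≟ᶠ atom _  = no λ ()
  (~ _)   ≟ᶠ (_ ∧ _) = no λ ()
  (~ _)   ≟ᶠ B _ _   = no λ ()
  (_ ∧ _) ≟ᶠ ⊤       = no λ ()
  (_ ∧ _) ≟ᶠ atom _  = no λ ()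
  (_ ∧ _) ≟ᶠ (~ _)   = no λ ()
  (_ ∧ _) ≟ᶠ B _ _   = no λ ()
  B _ _   ≟ᶠ ⊤       = no λ ()
  B _ _   ≟ᶠ atom _  = no λ ()
  B _ _   ≟ᶠ (~ _)   = no λ ()
  B _ _   ≟ᶠ (_ ∧ _) = no λ ()

  -- The conjunction of ψ a over a ∈ A, listed in increasing order and closed off
  -- with a final ⊤, so that the empty conjunction is ⊤.
  ⋀ : Subset n → (Ag → Formula) → Formula
  ⋀ A ψ = foldr _∧_ ⊤ (map ψ (filter (_∈? A) (allFin n)))

  -- A Kripke model whose set of worlds is not required to be non-empty: the
  -- product update with an arbitrary event model may have no worlds at all.
  record Structure (w r v : Level) : Set (lsuc (w ⊔ r ⊔ v)) where
    field
      W : Set w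
      R : Ag → Rel W r
      V : At → Pred W v

  record KripkeModel (w r v : Level) : Set (lsuc (w ⊔ r ⊔ v)) where
    field
      structure : Structure w r v
    open Structure structure public
    field
      nonempty : W

  open KripkeModel using (structure)

  infix 4 _at_⊨_

  _at_⊨_ : ∀ {w r v} (M : Structure w r v) → Structure.W M → Formula → Set (w ⊔ r ⊔ v)
  M at x ⊨ ⊤                      = Unit
  _at_⊨_ {w} {r} {v} M x (atom p) = Lift (w ⊔ r ⊔ v) (Structure.V M p x)
  M at x ⊨ (~ φ)                  = ¬ (M at x ⊨ φ)
  M at x ⊨ (φ ∧ ψ)                = (M at x ⊨ φ) × (M at x ⊨ ψ)
  M at x ⊨ B a φ                  = ∀ y → Structure.R M a x y → M at y ⊨ φ

  -- The quantification over all Kripke models has to be read relative to some universe levels.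
  Entails : ∀ w r v → Formula → Formula → Set (lsuc (w ⊔ r ⊔ v))
  Entails w r v φ ψ = (M : KripkeModel w r v) (x : KripkeModel.W M) →
                      structure M at x ⊨ φ → structure M at x ⊨ ψ

  infix 3 _≅_

  record _≅_ {w r v w′ r′ v′} (M : Structure w r v) (N : Structure w′ r′ v′)
             : Set (w ⊔ r ⊔ v ⊔ w′ ⊔ r′ ⊔ v′) where
    private
      module M = Structure M
      module N = Structure N
    field
      bijection : M.W ⤖ N.W
    open Bijection bijection using (to)
    field
      R-iff : ∀ a x y → M.R a x y ⇔ N.R a (to x) (to y)
      V-iff : ∀ p x → M.V p x ⇔ N.V p (to x)

  infixl 8 _÷_

  _÷_ : ∀ {w r v} → KripkeModel w r v → Formula → KripkeModel w (w ⊔ r ⊔ v) v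
  _÷_ {w} {r} {v} M φ = record
    { structure = record
        { W = M.W
        ; R = λ a x y → M.R a x y ⊎ ((structure M at x ⊨ B a φ) × (structure M at y ⊨ ~ φ))
        ; V = M.V
        }
    ; nonempty = M.nonempty
    }
    where module M = KripkeModel M

  record EventModel (q : Level) : Set (lsuc q) where
    field
      E        : Set
      nonempty : E
      finite   : ∃ λ (es : List E) → IsEnumeration (setoid E) es
      Q        : Ag → Rel E q
      Q⁺       : Ag → Rel E q
      pre      : E → Formula

  infixl 8 _⊗_

  -- Refinement types have irrelevant membership proofs, so two elements of the
  -- product are equal as soon as their underlying pairs (x , e) are.
  _⊗_ : ∀ {w r v q} → KripkeModel w r v → EventModel q → Structure (w ⊔ r ⊔ v) (r ⊔ q) v
  M ⊗ 𝓔 = record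
    { W = [ xe ∈ (M.W × 𝓔.E) ∣ structure M at proj₁ xe ⊨ 𝓔.pre (proj₂ xe) ]
    ; R = λ a s t → let (x , e) = value s ; (y , f) = value t in
            𝓔.Q⁺ a e f ⊎ (M.R a x y × 𝓔.Q a e f)
    ; V = λ p s → M.V p (proj₁ (value s))
    }
    where
    module M = KripkeModel M
    module 𝓔 = EventModel 𝓔

  allSubsets : ∀ m → List (Subset m)
  allSubsets zero    = [] ∷ []
  allSubsets (suc m) = map (inside ∷_) (allSubsets m) ++ map (outside ∷_) (allSubsets m)

  ∈-allSubsets : ∀ {m} (A : Subset m) → A ∈ allSubsets m
  ∈-allSubsets []            = here refl
  ∈-allSubsets (inside  ∷ A) = ∈-++⁺ˡ (∈-map⁺ (inside ∷_) (∈-allSubsets A))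
  ∈-allSubsets (outside ∷ A) = ∈-++⁺ʳ _ (∈-map⁺ (outside ∷_) (∈-allSubsets A))

  module _ (φ : Formula) where

    stateDescription : Formula → Subset n → Formula
    stateDescription ±φ A = ±φ ∧ ⋀ A (λ a → ~ B a φ) ∧ ⋀ (∁ A) (λ a → B a φ)

    IsEvent : Pred Formula lzero
    IsEvent ψ = (∃ λ A → ψ ≡ stateDescription φ A) ⊎ (∃ λ A → ψ ≡ stateDescription (~ φ) A)

    isEvent? : ∀ ψ → Dec (IsEvent ψ)
    isEvent? ψ = anySubset? (λ A → ψ ≟ᶠ stateDescription φ A)
           ⊎-dec anySubset? (λ A → ψ ≟ᶠ stateDescription (~ φ) A)

    Event : Set
    Event = [ ψ ∈ Formula ∣ IsEvent ψ ]

    event⁺ event⁻ : Subset n → Event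
    event⁺ A = stateDescription φ A     , [ inj₁ (A , refl) ]
    event⁻ A = stateDescription (~ φ) A , [ inj₂ (A , refl) ]

    allEvents : List Event
    allEvents = map event⁺ (allSubsets n) ++ map event⁻ (allSubsets n)

    ∈-allEvents : IsEnumeration (setoid Event) allEvents
    ∈-allEvents (ψ , [ p ]) with recompute (isEvent? ψ) p
    ... | inj₁ (A , refl) = ∈-++⁺ˡ (∈-map⁺ event⁺ (∈-allSubsets A))
    ... | inj₂ (A , refl) = ∈-++⁺ʳ _ (∈-map⁺ event⁻ (∈-allSubsets A))

  -- The event model for contraction on φ.  The levels w r v are those of the
  -- Kripke models over which entailment between preconditions is evaluated.
  𝓔÷ : ∀ w r v → Formula → EventModel (lsuc (w ⊔ r ⊔ v))
  𝓔÷ w r v φ = record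
    { E        = Event φ
    ; nonempty = event⁺ φ ∅
    ; finite   = allEvents φ , ∈-allEvents φ
    ; Q        = λ a e f → Unit
    ; Q⁺       = λ a e f → Entails w r v (pre e) (B a φ) × Entails w r v (pre f) (~ φ)
    ; pre      = pre
    }
    where
    pre : Event φ → Formula
    pre = value

{-# OPTIONS --safe #-}

-- Exactly one of the formulas in E holds at any given world x: whether φ is a
-- conjunct or ¬φ is depends on the truth value of φ at x, and A is forced to be
-- {a : x ⊭ B_a φ}.  Sending x to x paired with that formula is thus a bijection.
-- The formula also records whether x satisfies B_a φ and ¬φ, so the edges added
-- by Q⁺ are those added by contraction.
module Submission where

open import Defs
open import Axiom.ExcludedMiddle using (ExcludedMiddle)
open import Data.Fin.Base using (Fin)
open import Data.Fin.Subset using (Subset; ∁; _∈_)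
open import Data.Fin.Subset.Properties
  using (_∈?_; ⊆-antisym; x∈∁p⇒x∉p; x∉p⇒x∈∁p)
open import Data.Irrelevant using ([_])
open import Data.List.Base using ([]; _∷_; map; filter; foldr; allFin)
open import Data.List.Membership.Propositional.Properties
  using (∈-filter⁺; ∈-filter⁻; ∈-allFin)
open import Data.List.Relation.Unary.All as All using (All; []; _∷_)
open import Data.List.Relation.Unary.All.Properties using (map⁺; map⁻)
open import Data.Nat.Base using (ℕ)
open import Data.Product.Base using (∃; _,_; proj₁; proj₂)
open import Data.Refinement using (value; _,_)
open import Data.Refinement.Properties using (value-injective)
open import Data.Sum.Base using (inj₁; inj₂)
open import Data.Vec.Base using (tabulate)
open import Data.Vec.Properties using ([]=⇒lookup; lookup⇒[]=; lookup∘tabulate)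
open import Function.Base using (_∘_)
open import Function.Bundles using (_↣_; _⇔_; mk⇔; mk⤖; module Equivalence)
open import Function.Construct.Identity using (⇔-id)
open import Level using (Level; _⊔_)
open import Relation.Binary.PropositionalEquality
  using (_≡_; refl; sym; trans; cong)
open import Relation.Nullary.Decidable
  using (yes; no; does; dec-true; decidable-stable; recompute)
open import Relation.Nullary.Negation.Core using (contradiction)
open import Relation.Unary using (Pred; Decidable)

open Equivalence using (to; from)

⟦_⟧ : ∀ {n ℓ} {P : Pred (Fin n) ℓ} → Decidable P → Subset n
⟦ P? ⟧ = tabulate (does ∘ P?)

∈-⟦⟧ : ∀ {n ℓ} {P : Pred (Fin n) ℓ} (P? : Decidable P) → ∀ i → i ∈ ⟦ P? ⟧ ⇔ P i
∈-⟦⟧ {P = P} P? i = mk⇔ sound complete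
  where
  sound : i ∈ ⟦ P? ⟧ → P i
  -- Abstracting `P? i` together with this equation makes the equation compute: in the `no` case it
  -- reads `false ≡ true`.
  sound i∈ with P? i | trans (sym (lookup∘tabulate (does ∘ P?) i)) ([]=⇒lookup i∈)
  ... | yes p | _  = p
  ... | no _  | ()

  complete : P i → i ∈ ⟦ P? ⟧
  complete p = lookup⇒[]= i ⟦ P? ⟧
    (trans (lookup∘tabulate (does ∘ P?) i) (dec-true (P? i) p))

subset-unique : ∀ {n ℓ} {P : Pred (Fin n) ℓ} {A A′ : Subset n} →
  (∀ i → i ∈ A ⇔ P i) → (∀ i → i ∈ A′ ⇔ P i) → A ≡ A′
subset-unique A⇔P A′⇔P = ⊆-antisym
  (λ {i} → from (A′⇔P i) ∘ to (A⇔P i)) (λ {i} → from (A⇔P i) ∘ to (A′⇔P i))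

module _ {At : Set} {At-countable : At ↣ ℕ} {n : ℕ} where

  open Doxastic At At-countable n

  module _ {w r v : Level} (M : Structure w r v) (x : Structure.W M) where

    foldr-∧⁺ : ∀ {ψs} → All (M at x ⊨_) ψs → M at x ⊨ foldr _∧_ ⊤ ψs
    foldr-∧⁺ []       = _
    foldr-∧⁺ (p ∷ ps) = p , foldr-∧⁺ ps

    foldr-∧⁻ : ∀ ψs → M at x ⊨ foldr _∧_ ⊤ ψs → All (M at x ⊨_) ψs
    foldr-∧⁻ []       _        = []
    foldr-∧⁻ (_ ∷ ψs) (p , ps) = p ∷ foldr-∧⁻ ψs ps

    ⋀⁺ : ∀ A ψ → (∀ a → a ∈ A → M at x ⊨ ψ a) → M at x ⊨ ⋀ A ψ
    ⋀⁺ A ψ h = foldr-∧⁺ (map⁺ (All.tabulate λ {a} a∈ →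
      h a (proj₂ (∈-filter⁻ (_∈? A) {xs = allFin n} a∈))))

    ⋀⁻ : ∀ A ψ → M at x ⊨ ⋀ A ψ → ∀ a → a ∈ A → M at x ⊨ ψ a
    ⋀⁻ A ψ h a a∈A = All.lookup
      (map⁻ (foldr-∧⁻ (map ψ (filter (_∈? A) (allFin n))) h))
      (∈-filter⁺ (_∈? A) (∈-allFin a) a∈A)

    module _ (φ : Formula) where

      Disbelief : Ag → Set (w ⊔ r ⊔ v)
      Disbelief a = M at x ⊨ ~ B a φ

      -- If `a` were outside `A`, then `B a φ` would be a conjunct and refute `Disbelief a`.
      -- Membership in `A` is decidable, so this double negation is eliminated without excluded
      -- middle.
      description⁻ : ∀ ±φ A → M at x ⊨ stateDescription φ ±φ A → ∀ a → a ∈ A ⇔ Disbelief a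
      description⁻ ±φ A (_ , disbeliefs , beliefs) a = mk⇔
        (⋀⁻ A (λ b → ~ B b φ) disbeliefs a)
        (λ ¬Bφ → decidable-stable (a ∈? A) λ a∉A →
          ¬Bφ (⋀⁻ (∁ A) (λ b → B b φ) beliefs a (x∉p⇒x∈∁p a∉A)))

      -- For equal signs, both index sets coincide with the agents in `Disbelief`; for opposite
      -- signs, the leading conjuncts contradict each other.
      description-unique : ∀ {ψ χ} → IsEvent φ ψ → IsEvent φ χ →
        M at x ⊨ ψ → M at x ⊨ χ → ψ ≡ χ
      description-unique (inj₁ (A , refl)) (inj₁ (A′ , refl)) p q =
        cong (stateDescription φ φ)
          (subset-unique (description⁻ φ A p) (description⁻ φ A′ q))
      description-unique (inj₂ (A , refl)) (inj₂ (A′ , refl)) p q =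
        cong (stateDescription φ (~ φ))
          (subset-unique (description⁻ (~ φ) A p) (description⁻ (~ φ) A′ q))
      description-unique (inj₁ (A , refl)) (inj₂ (A′ , refl)) p q =
        contradiction (proj₁ p) (proj₁ q)
      description-unique (inj₂ (A , refl)) (inj₁ (A′ , refl)) p q =
        contradiction (proj₁ q) (proj₁ p)

      event-unique : (e f : Event φ) → M at x ⊨ value e → M at x ⊨ value f → e ≡ f
      event-unique (ψ , [ ψ-event ]) (χ , [ χ-event ]) p q = value-injective
        -- An event carries its `IsEvent` proof irrelevantly; deciding `IsEvent` again yields a
        -- proof that can be inspected.
        (description-unique (recompute (isEvent? φ ψ) ψ-event)
                            (recompute (isEvent? φ χ) χ-event) p q)

      module _ (em : ExcludedMiddle (w ⊔ r ⊔ v)) where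

        disbelievers : Subset n
        disbelievers = ⟦ (λ a → em {Disbelief a}) ⟧

        description⁺ : ∀ ±φ → M at x ⊨ ±φ → M at x ⊨ stateDescription φ ±φ disbelievers
        description⁺ ±φ p = p
          , ⋀⁺ disbelievers (λ a → ~ B a φ) (λ a → to (A⇔ a))
          , ⋀⁺ (∁ disbelievers) (λ a → B a φ)
              (λ a a∈ → decidable-stable em λ ¬Bφ → x∈∁p⇒x∉p a∈ (from (A⇔ a) ¬Bφ))
          where
          A⇔ : ∀ a → a ∈ disbelievers ⇔ Disbelief a
          A⇔ = ∈-⟦⟧ (λ a → em)

        event-exists : ∃ λ (e : Event φ) → M at x ⊨ value e
        event-exists with em {M at x ⊨ φ}
        ... | yes p = event⁺ φ disbelievers , description⁺ φ p
        ... | no ¬p = event⁻ φ disbelievers , description⁺ (~ φ) ¬p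

  module _ {w r v : Level} (φ : Formula) where

    -- Passes from one world to all models: a single world satisfying both `ψ` and `B a φ` shows
    -- that `a` lies outside the index set of `ψ`. Hence `B a φ` is literally a conjunct of `ψ`, and
    -- so holds wherever `ψ` does.
    description-entails-B : ∀ {ψ} → IsEvent φ ψ →
      (M : KripkeModel w r v) (x : KripkeModel.W M) (a : Ag) →
      KripkeModel.structure M at x ⊨ ψ → KripkeModel.structure M at x ⊨ B a φ →
      Entails w r v ψ (B a φ)
    description-entails-B isEvent M x a p Bφ = entails isEvent p
      where
      transfer : ∀ ±φ A → KripkeModel.structure M at x ⊨ stateDescription φ ±φ A →
        Entails w r v (stateDescription φ ±φ A) (B a φ)
      transfer ±φ A p N y (_ , _ , beliefs) =
        ⋀⁻ (KripkeModel.structure N) y (∁ A) (λ b → B b φ) beliefs a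
          (x∉p⇒x∈∁p λ a∈A →
            to (description⁻ (KripkeModel.structure M) x φ ±φ A p a) a∈A Bφ)

      entails : ∀ {ψ} → IsEvent φ ψ → KripkeModel.structure M at x ⊨ ψ →
        Entails w r v ψ (B a φ)
      entails (inj₁ (A , refl)) = transfer φ A
      entails (inj₂ (A , refl)) = transfer (~ φ) A

    -- One world satisfying `~ φ` excludes the positive sign, so `~ φ` is the leading conjunct of
    -- `ψ`.
    description-entails-~ : ∀ {ψ} → IsEvent φ ψ →
      (M : KripkeModel w r v) (x : KripkeModel.W M) →
      KripkeModel.structure M at x ⊨ ψ → KripkeModel.structure M at x ⊨ ~ φ →
      Entails w r v ψ (~ φ)
    description-entails-~ (inj₁ (A , refl)) M x p ¬φ = contradiction (proj₁ p) ¬φ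
    description-entails-~ (inj₂ (A , refl)) M x p ¬φ N y = proj₁

proposition7p4 : ∀ {w r v : Level} → ExcludedMiddle (w ⊔ r ⊔ v) →
    (At : Set) (At-countable : At ↣ ℕ) (n : ℕ) →
    let open Doxastic At At-countable n in
    (M : KripkeModel w r v) (φ : Formula) →
    KripkeModel.structure (M ÷ φ) ≅ M ⊗ 𝓔÷ w r v φ
proposition7p4 {w} {r} {v} em At At-countable n M φ = record
  { bijection = mk⤖ {to = embed}
      -- The world is the first component of its image, which gives both injectivity and the
      -- preimage of `s`.
      (cong (proj₁ ∘ value) , λ s → proj₁ (value s) , λ { refl → onto s })
  ; R-iff     = λ a x y → mk⇔
      (λ { (inj₁ xRy)       → inj₂ (xRy , _)
         ; (inj₂ (Bφ , ¬φ)) → inj₁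
             ( description-entails-B φ (isEvent x) M x a (holds x) Bφ
             , description-entails-~ φ (isEvent y) M y (holds y) ¬φ ) })
      -- Conversely, the entailments are instantiated at `M` itself, whose levels are those fixed in
      -- `𝓔÷`.
      (λ { (inj₁ (⊨Bφ , ⊨~φ)) → inj₂ (⊨Bφ M x (holds x) , ⊨~φ M y (holds y))
         ; (inj₂ (xRy , _))     → inj₁ xRy })
  ; V-iff     = λ p x → ⇔-id _
  }
  where
  open Doxastic At At-countable n
  module M = KripkeModel M

  eventAt : M.W → Event φ
  eventAt x = proj₁ (event-exists M.structure x φ em)

  holds : ∀ x → M.structure at x ⊨ value (eventAt x)
  holds x = proj₂ (event-exists M.structure x φ em)

  isEvent : ∀ x → IsEvent φ (value (eventAt x))
  isEvent x with eventAt x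
  ... | ψ , [ p ] = recompute (isEvent? φ ψ) p

  embed : M.W → Structure.W (M ⊗ 𝓔÷ w r v φ)
  embed x = (x , eventAt x) , [ holds x ]

  onto : ∀ s → embed (proj₁ (value s)) ≡ s
  onto ((x , e) , [ p ]) = value-injective
    -- The satisfaction proof `p` is irrelevant; excluded middle decides the proposition and so
    -- recovers a usable proof.
    (cong (x ,_) (event-unique M.structure x φ (eventAt x) e (holds x) (recompute em p)))
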